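{- Let $p$ be a prime number and let $n$ be a positive integer. Then $S_n(n)\equiv p \pmod{n}$ (i.e. $n\in\mathcal{M}_p$) if and only if all of the following hold: (i) the prime power factorization of $n$ has the form $n=p^s q_1\cdots q_r$, where $0\le s\le 2$ and $q_1,\dots,q_r$ are pairwise distinct primes different from $p$ (each appearing with exponent $1$); (ii) for every $i\in\{1,\dots,r\}$, $q_i-1$ divides $n$ and $n/q_i+p\equiv 0\pmod{q_i}$; (iii) if $s=1$, then $p-1\nmid n$; (iv) if $s=2$, then $p-1\mid n$ and $n/p^2+1\equiv 0\pmod{p}$.
   Context: For positive integers $k,n$ let $S_k(n)=\sum_{i=1}^{n} i^k$. For an integer $a$, $\mathcal{M}_a$ denotes the set of positive integers $n$ such that $S_n(n)\equiv a\pmod{n}$. -}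

module Defs where

open import Data.Integer.Base using (ℤ; +_; _-_)
import Data.Integer.Divisibility as ℤ
open import Data.List.Base using (List; applyUpTo)
open import Data.List.Membership.Propositional using (_∈_)
open import Data.List.Relation.Unary.All using (All; lookup)
open import Data.List.Relation.Unary.Unique.Propositional using (Unique)
open import Data.Nat.Base using (ℕ; suc; _*_; _^_; _≤_; NonZero)
open import Data.Nat.ListAction using (product; sum)
open import Data.Nat.Primality using (Prime; prime⇒nonZero)
open import Data.Product.Base using (_×_)
open import Level using (0ℓ)
open import Relation.Binary.PropositionalEquality.Core using (_≡_; _≢_)
open import Relation.Unary using (Pred)

infix 4 _≡_[mod_]

_≡_[mod_] : ℤ → ℤ → ℕ → Set
a ≡ b [mod n ] = + n ℤ.∣ a - b

-- applyUpTo f n lists f 0 , … , f (n ∸ 1), so suc i runs over 1 , … , n.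
S : ℕ → ℕ → ℕ
S k n = sum (applyUpTo (λ i → suc i ^ k) n)

𝓜 : ℤ → Pred ℕ 0ℓ
𝓜 a n = NonZero n × + S n n ≡ a [mod n ]

record FactorisationAt (p n : ℕ) : Set where
  field
    s               : ℕ
    qs              : List ℕ
    s≤2             : s ≤ 2
    isFactorisation : n ≡ p ^ s * product qs
    qs-prime        : All Prime qs
    qs-distinct     : Unique qs
    qs≢p            : All (_≢ p) qs

  qs-nonZero : ∀ {q} → q ∈ qs → NonZero q
  qs-nonZero q∈qs = prime⇒nonZero (lookup qs-prime q∈qs)

{-# OPTIONS --safe #-}

-- Let q be a prime and n = m q. Since (i + q)^n ≡ i^n (mod q²) when q ∣ n, summing over m blocks of
-- length q gives S n n ≡ m · S n q (mod q²). Modulo q, the sum S n q is −1 if q − 1 ∣ n (Fermat)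
-- and 0 otherwise. For q ≠ p this turns S n n ≡ p (mod q) into q − 1 ∣ n and n/q + p ≡ 0 (mod q),
-- and it excludes q² ∣ n, where n/q ≡ 0. If p² ∣ n, then dividing p ≡ (n/p) · S n p (mod p²) by p
-- gives 1 ≡ (n/p²) · S n p (mod p), which is condition (iv) and excludes p³ ∣ n. The converse
-- glues the congruences modulo p^s and the q_i by the Chinese remainder theorem.

module Submission where

open import Defs
open import Data.List.Membership.Propositional using () renaming (_∈_ to _∈ₗ_)
open import Data.Nat.Base using (ℕ; _+_; _∸_; _^_; _/_; NonZero)
open import Data.Nat.Divisibility using (_∣_; _∤_)
open import Data.Nat.Primality using (Prime; prime⇒nonZero)
open import Data.Nat.Properties using (m^n≢0)
open import Data.Product.Base using (Σ-syntax; _×_)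
open import Function.Bundles using (_⇔_)
open import Relation.Binary.PropositionalEquality.Core using (_≡_)
open import Relation.Unary using (_∈_)

open import Data.Integer.Properties using ([+m]-[+n]≡m⊖n; ∣⊖∣-≤; ∣m⊖n∣≡∣n⊖m∣)
open import Data.List.Base using (List; []; _∷_; applyUpTo)
open import Data.List.Relation.Unary.All as All using (All; []; _∷_)
open import Data.List.Relation.Unary.AllPairs using ([]; _∷_)
open import Data.List.Relation.Unary.Any using (here; there)
open import Data.List.Relation.Unary.Unique.Propositional using (Unique)
open import Data.Nat.Base hiding (ℕ; _+_; _∸_; _^_; _/_; NonZero)
open import Data.Nat.Combinatorics
  using (_C_; nC1≡n; nCk≡nC[n∸k]; nCn≡1; nCk+nC[k+1]≡[n+1]C[k+1])
open import Data.Nat.Combinatorics.Specification using (k>n⇒nCk≡0)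
open import Data.Nat.Coprimality using (Coprime; coprime-divisor; 1-coprimeTo)
open import Data.Nat.Divisibility hiding (_∣_; _∤_)
open import Data.Nat.DivMod using (_%_; m≡m%n+[m/n]*n; m%n<n; m/n*n≡m)
open import Data.Nat.Induction using (<-rec)
open import Data.Nat.ListAction using (sum; product)
open import Data.Nat.ListAction.Properties using (∈⇒∣product)
open import Data.Nat.Primality hiding (Prime; prime⇒nonZero)
open import Data.Nat.Primality.Factorisation
  using (PrimeFactorisation; factorise; factorisationHasAllPrimeFactors)
open import Data.Nat.Properties hiding (m^n≢0)
open import Data.Nat.Tactic.RingSolver using (solve-∀)
open import Data.Product.Base using (_,_; ∃-syntax; proj₂; map₂; swap)
open import Data.Sum.Base using (inj₁; inj₂; [_,_]′)
open import Function.Base using (_∘_; id)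
open import Function.Bundles using (mk⇔; module Equivalence)
open import Level using (0ℓ)
open import Relation.Binary.Bundles using (Setoid)
open import Relation.Binary.PropositionalEquality hiding (_≡_)
import Relation.Binary.Reasoning.Setoid as SetoidReasoning
open import Relation.Nullary using (yes; no; contradiction)

private variable
  a b c d k m n p q : ℕ

-- Finite sums

∑ : ℕ → (ℕ → ℕ) → ℕ
∑ n f = sum (applyUpTo f n)

∑-cong : ∀ n {f g} → (∀ i → f i ≡ g i) → ∑ n f ≡ ∑ n g
∑-cong zero    f≡g = refl
∑-cong (suc n) f≡g = cong₂ _+_ (f≡g 0) (∑-cong n (f≡g ∘ suc))

∑-zero : ∀ n → ∑ n (λ _ → 0) ≡ 0
∑-zero zero    = refl
∑-zero (suc n) = ∑-zero n

∑-const : ∀ n c → ∑ n (λ _ → c) ≡ n * c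
∑-const zero    c = refl
∑-const (suc n) c = cong (c +_) (∑-const n c)

∑-+ : ∀ n f g → ∑ n (λ i → f i + g i) ≡ ∑ n f + ∑ n g
∑-+ zero    f g = refl
∑-+ (suc n) f g = trans (cong (f 0 + g 0 +_) (∑-+ n (f ∘ suc) (g ∘ suc))) (interchange (f 0) (g 0) _ _)
  where
  interchange : ∀ a b c d → a + b + (c + d) ≡ a + c + (b + d)
  interchange = solve-∀

∑-* : ∀ n c f → ∑ n (λ i → c * f i) ≡ c * ∑ n f
∑-* zero    c f = sym (*-zeroʳ c)
∑-* (suc n) c f = trans (cong (c * f 0 +_) (∑-* n c (f ∘ suc))) (sym (*-distribˡ-+ c (f 0) _))

∑-last : ∀ n f → ∑ (suc n) f ≡ ∑ n f + f n
∑-last zero    f = +-comm (f 0) 0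
∑-last (suc n) f = trans (cong (f 0 +_) (∑-last n (f ∘ suc))) (sym (+-assoc (f 0) _ _))

∑-split : ∀ m n f → ∑ (m + n) f ≡ ∑ m f + ∑ n (λ i → f (m + i))
∑-split zero    n f = refl
∑-split (suc m) n f = trans (cong (f 0 +_) (∑-split m n (f ∘ suc))) (sym (+-assoc (f 0) _ _))

∑-swap : ∀ m n (f : ℕ → ℕ → ℕ) → ∑ m (λ i → ∑ n (f i)) ≡ ∑ n (λ j → ∑ m (λ i → f i j))
∑-swap zero    n f = sym (∑-zero n)
∑-swap (suc m) n f = trans (cong (∑ n (f 0) +_) (∑-swap m n (f ∘ suc))) (sym (∑-+ n (f 0) _))

-- Congruence of natural numbers

infix 4 _≈_[_]

-- Moving the multiples of m to opposite sides keeps congruence free of truncated subtraction.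
record _≈_[_] (a b m : ℕ) : Set where
  constructor cong-mod
  field
    x y : ℕ
    eq  : a + x * m ≡ b + y * m

≈-refl : a ≈ a [ m ]
≈-refl = cong-mod 0 0 refl

≈-reflexive : a ≡ b → a ≈ b [ m ]
≈-reflexive refl = ≈-refl

≈-sym : a ≈ b [ m ] → b ≈ a [ m ]
≈-sym (cong-mod x y eq) = cong-mod y x (sym eq)

≈-trans : a ≈ b [ m ] → b ≈ c [ m ] → a ≈ c [ m ]
≈-trans {a} {b} {m} {c} (cong-mod x y eq) (cong-mod z w eq′) = cong-mod (x + z) (y + w) (begin
  a + (x + z) * m      ≡⟨ l₁ a x z m ⟩
  a + x * m + z * m    ≡⟨ cong (_+ z * m) eq ⟩
  b + y * m + z * m    ≡⟨ l₂ b y z m ⟩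
  b + z * m + y * m    ≡⟨ cong (_+ y * m) eq′ ⟩
  c + w * m + y * m    ≡⟨ l₃ c w y m ⟩
  c + (y + w) * m      ∎)
  where
  open ≡-Reasoning
  l₁ : ∀ a x z m → a + (x + z) * m ≡ a + x * m + z * m
  l₁ = solve-∀
  l₂ : ∀ a x z m → a + x * m + z * m ≡ a + z * m + x * m
  l₂ = solve-∀
  l₃ : ∀ a x z m → a + x * m + z * m ≡ a + (z + x) * m
  l₃ = solve-∀

≈-+ : a ≈ b [ m ] → c ≈ d [ m ] → a + c ≈ b + d [ m ]
≈-+ {a} {b} {m} {c} {d} (cong-mod x y eq) (cong-mod z w eq′) = cong-mod (x + z) (y + w) (begin
  a + c + (x + z) * m        ≡⟨ l a c x z m ⟩
  a + x * m + (c + z * m)    ≡⟨ cong₂ _+_ eq eq′ ⟩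
  b + y * m + (d + w * m)    ≡⟨ sym (l b d y w m) ⟩
  b + d + (y + w) * m        ∎)
  where
  open ≡-Reasoning
  l : ∀ a c x z m → a + c + (x + z) * m ≡ a + x * m + (c + z * m)
  l = solve-∀

≈-*ˡ : ∀ c → a ≈ b [ m ] → c * a ≈ c * b [ m ]
≈-*ˡ {a} {b} {m} c (cong-mod x y eq) = cong-mod (c * x) (c * y)
  (trans (l c a x m) (trans (cong (c *_) eq) (sym (l c b y m))))
  where
  l : ∀ c a x m → c * a + c * x * m ≡ c * (a + x * m)
  l = solve-∀

≈-* : a ≈ b [ m ] → c ≈ d [ m ] → a * c ≈ b * d [ m ]
≈-* {a} {b} {m} {c} {d} p q = ≈-trans (≈-*ˡ a q)
  (subst₂ (_≈_[ m ]) (*-comm d a) (*-comm d b) (≈-*ˡ d p))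

≈-^ : ∀ k → a ≈ b [ m ] → a ^ k ≈ b ^ k [ m ]
≈-^ zero    p = ≈-refl
≈-^ (suc k) p = ≈-* p (≈-^ k p)

≈-+-cancelˡ : ∀ c → c + a ≈ c + b [ m ] → a ≈ b [ m ]
≈-+-cancelˡ {a} {b} {m} c (cong-mod x y eq) = cong-mod x y
  (+-cancelˡ-≡ c _ _ (trans (sym (+-assoc c a _)) (trans eq (+-assoc c b _))))

≈-+-cancelʳ : ∀ c → a + c ≈ b + c [ m ] → a ≈ b [ m ]
≈-+-cancelʳ {a} {b} {m} c p = ≈-+-cancelˡ c (subst₂ (_≈_[ m ]) (+-comm a c) (+-comm b c) p)

≈-scale : ∀ c → a ≈ b [ m ] → c * a ≈ c * b [ c * m ]
≈-scale {a} {b} {m} c (cong-mod x y eq) = cong-mod x y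
  (trans (l c a x m) (trans (cong (c *_) eq) (sym (l c b y m))))
  where
  l : ∀ c a x m → c * a + x * (c * m) ≡ c * (a + x * m)
  l = solve-∀

≈-unscale : ∀ c .{{_ : NonZero c}} → c * a ≈ c * b [ c * m ] → a ≈ b [ m ]
≈-unscale {a} {b} {m} c (cong-mod x y eq) = cong-mod x y
  (*-cancelˡ-≡ _ _ c (trans (sym (l c a x m)) (trans eq (l c b y m))))
  where
  l : ∀ c a x m → c * a + x * (c * m) ≡ c * (a + x * m)
  l = solve-∀

≈-∣ : d ∣ m → a ≈ b [ m ] → a ≈ b [ d ]
≈-∣ {d} {a = a} {b = b} (divides-refl e) (cong-mod x y eq) = cong-mod (x * e) (y * e)
  (trans (cong (a +_) (*-assoc x e d)) (trans eq (cong (b +_) (sym (*-assoc y e d)))))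

∣⇒≈0 : m ∣ a → a ≈ 0 [ m ]
∣⇒≈0 (divides k eq) = cong-mod 0 k (trans (+-identityʳ _) eq)

≈0⇒∣ : a ≈ 0 [ m ] → m ∣ a
≈0⇒∣ {a} {m} (cong-mod x y eq) =
  ∣m+n∣m⇒∣n (subst (m ∣_) (trans (sym eq) (+-comm a _)) (n∣m*n y)) (n∣m*n x)

≈⇒∣∸ : a ≤ b → a ≈ b [ m ] → m ∣ b ∸ a
≈⇒∣∸ {a} a≤b p = ≈0⇒∣ (≈-+-cancelˡ a (≈-trans (≈-reflexive (m+[n∸m]≡n a≤b))
  (≈-trans (≈-sym p) (≈-reflexive (sym (+-identityʳ a))))))

∣∸⇒≈ : a ≤ b → m ∣ b ∸ a → a ≈ b [ m ]
∣∸⇒≈ {a} {b} {m} a≤b p = subst₂ (_≈_[ m ]) (+-identityʳ a) (m+[n∸m]≡n a≤b)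
  (≈-+ (≈-refl {a}) (≈-sym (∣⇒≈0 p)))

≈-setoid : ℕ → Setoid 0ℓ 0ℓ
≈-setoid m = record
  { Carrier       = ℕ
  ; _≈_           = λ a b → a ≈ b [ m ]
  ; isEquivalence = record { refl = ≈-refl ; sym = ≈-sym ; trans = ≈-trans }
  }

module ≈-Reasoning (m : ℕ) = SetoidReasoning (≈-setoid m)

coprime-∣-* : Coprime m n → m ∣ a → n ∣ a → m * n ∣ a
coprime-∣-* {m} {n} c (divides-refl k) n∣k*m =
  subst (m * n ∣_) (*-comm m k) (*-monoʳ-∣ m (coprime-divisor (c ∘ swap) (subst (n ∣_) (*-comm k m) n∣k*m)))

≈-coprime-* : Coprime m n → a ≈ b [ m ] → a ≈ b [ n ] → a ≈ b [ m * n ]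
≈-coprime-* {m} {n} {a} {b} c p q with ≤-total a b
... | inj₁ a≤b = ∣∸⇒≈ a≤b (coprime-∣-* c (≈⇒∣∸ a≤b p) (≈⇒∣∸ a≤b q))
... | inj₂ b≤a = ≈-sym (∣∸⇒≈ b≤a (coprime-∣-* c (≈⇒∣∸ b≤a (≈-sym p)) (≈⇒∣∸ b≤a (≈-sym q))))

-- Periodic sums and the reduction of `S n n` to one block

∑-≈ : ∀ n {f g} → (∀ i → i < n → f i ≈ g i [ m ]) → ∑ n f ≈ ∑ n g [ m ]
∑-≈ zero    f≈g = ≈-refl
∑-≈ (suc n) f≈g = ≈-+ (f≈g 0 z<s) (∑-≈ n λ i i<n → f≈g (suc i) (s<s i<n))

∑-≈0 : ∀ n {f} → (∀ i → i < n → f i ≈ 0 [ m ]) → ∑ n f ≈ 0 [ m ]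
∑-≈0 n f≈0 = ≈-trans (∑-≈ n f≈0) (≈-reflexive (∑-zero n))

∑-periodic : ∀ m d {f} → (∀ i → f (d + i) ≈ f i [ k ]) → ∑ (m * d) f ≈ m * ∑ d f [ k ]
∑-periodic zero    d period = ≈-refl
∑-periodic {k} (suc m) d {f} period = begin
  ∑ (d + m * d) f                         ≡⟨ ∑-split d (m * d) f ⟩
  ∑ d f + ∑ (m * d) (λ i → f (d + i))     ≈⟨ ≈-+ ≈-refl (∑-≈ (m * d) λ i _ → period i) ⟩
  ∑ d f + ∑ (m * d) f                     ≈⟨ ≈-+ ≈-refl (∑-periodic m d period) ⟩
  ∑ d f + m * ∑ d f                       ∎
  where open ≈-Reasoning k

-- The binomial expansion cut off after the linear term. Only the existence of the cofactor of h²
-- matters, so a direct induction replaces binomial coefficients; the exponent `suc n` keeps the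
-- derivative term free of subtraction.
[a+h]^n-expansion : ∀ a h n → ∃[ c ] (a + h) ^ suc n ≡ a ^ suc n + suc n * a ^ n * h + c * (h * h)
[a+h]^n-expansion a h zero    = 0 , l a h
  where
  l : ∀ a h → (a + h) * 1 ≡ a * 1 + 1 * 1 * h + 0 * (h * h)
  l = solve-∀
[a+h]^n-expansion a h (suc n) with [a+h]^n-expansion a h n
-- After multiplication by `a + h`, these are the terms divisible by h²: `h` times the old linear
-- term, and both multiples of the old remainder.
... | c , eq = suc n * a ^ n + a * c + h * c , trans (cong ((a + h) *_) eq) (l a h n (a ^ n) c)
  where
  l : ∀ a h n b c → (a + h) * (a * b + (1 + n) * b * h + c * (h * h)) ≡
      a * (a * b) + (2 + n) * (a * b) * h + ((1 + n) * b + a * c + h * c) * (h * h)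
  l = solve-∀

-- The linear term n a^(n-1) q of the expansion already contains q², because `q` divides the
-- exponent.
^-periodic : ∀ n a → q ∣ n → (a + q) ^ n ≈ a ^ n [ q * q ]
^-periodic zero a _ = ≈-refl
^-periodic {q} (suc n) a (divides k eq) with [a+h]^n-expansion a q n
... | c , eq′ = cong-mod 0 (k * a ^ n + c) (begin
  (a + q) ^ suc n + 0                                ≡⟨ +-identityʳ _ ⟩
  (a + q) ^ suc n                                    ≡⟨ eq′ ⟩
  a ^ suc n + suc n * a ^ n * q + c * (q * q)
    ≡⟨ cong (λ ∙ → a ^ suc n + ∙ * a ^ n * q + c * (q * q)) eq ⟩
  a ^ suc n + k * q * a ^ n * q + c * (q * q)        ≡⟨ l (a ^ suc n) k q (a ^ n) c ⟩
  a ^ suc n + (k * a ^ n + c) * (q * q)              ∎)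
  where
  open ≡-Reasoning
  l : ∀ a k q b c → a + k * q * b * q + c * (q * q) ≡ a + (k * b + c) * (q * q)
  l = solve-∀

-- The modulus is q² rather than `q` so that one factor can still be divided out when q² divides
-- `n`.
S≈mS : ∀ m → n ≡ m * q → S n n ≈ m * S n q [ q * q ]
S≈mS {q = q} m refl = ∑-periodic m q λ i → ≈-trans
  (≈-reflexive (cong (λ j → suc j ^ (m * q)) (+-comm q i)))
  (^-periodic (m * q) (suc i) (n∣m*n m))

-- Binomial theorem and Fermat's little theorem

-- The absorption identity, by induction on `n` with Pascal's rule on both sides. It exposes the
-- factor `suc n` needed for `prime⇒∣C`.
[k+1]*[n+1]C[k+1]≡[n+1]*nCk : ∀ n k → suc k * (suc n C suc k) ≡ suc n * (n C k)
[k+1]*[n+1]C[k+1]≡[n+1]*nCk zero zero = refl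
[k+1]*[n+1]C[k+1]≡[n+1]*nCk zero (suc k) = *-zeroʳ (2 + k)
[k+1]*[n+1]C[k+1]≡[n+1]*nCk n@(suc m) zero =
  trans (+-identityʳ _) (trans (nC1≡n (suc n)) (sym (*-identityʳ (suc n))))
[k+1]*[n+1]C[k+1]≡[n+1]*nCk n@(suc m) k@(suc j) = begin
  suc k * (suc n C suc k)                            ≡⟨ cong (suc k *_) (nCk+nC[k+1]≡[n+1]C[k+1] n k) ⟨
  suc k * (n C k + n C suc k)                        ≡⟨ *-distribˡ-+ (suc k) (n C k) (n C suc k) ⟩
  n C k + k * (n C k) + suc k * (n C suc k)
    ≡⟨ cong₂ (λ x y → n C k + x + y) ([k+1]*[n+1]C[k+1]≡[n+1]*nCk m j) ([k+1]*[n+1]C[k+1]≡[n+1]*nCk m k) ⟩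
  n C k + n * (m C j) + n * (m C k)                  ≡⟨ +-assoc (n C k) _ _ ⟩
  n C k + (n * (m C j) + n * (m C k))
    ≡⟨ cong (n C k +_) (*-distribˡ-+ n (m C j) (m C k)) ⟨
  n C k + n * (m C j + m C k)
    ≡⟨ cong (λ x → n C k + n * x) (nCk+nC[k+1]≡[n+1]C[k+1] m j) ⟩
  n C k + n * (n C k)                                ∎
  where open ≡-Reasoning

binomial : ∀ n a → suc a ^ n ≡ ∑ (suc n) (λ k → (n C k) * a ^ k)
binomial zero    a = refl
binomial (suc n) a = sym (begin
  ∑ (suc (suc n)) (λ k → (suc n C k) * a ^ k)                       ≡⟨ cong suc (∑-cong (suc n) pascal) ⟩
  suc (∑ (suc n) (λ k → a * t k + t (suc k)))
    ≡⟨ cong suc (∑-+ (suc n) (λ k → a * t k) (t ∘ suc)) ⟩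
  suc (∑ (suc n) (λ k → a * t k) + ∑ (suc n) (t ∘ suc))
    ≡⟨ cong₂ (λ x y → suc (x + y)) (∑-* (suc n) a t) (∑-last n (t ∘ suc)) ⟩
  suc (a * ∑ (suc n) t + (∑ n (t ∘ suc) + t (suc n)))
    -- Pascal's rule at the top index yields the coefficient n C (n+1), which is 0, so the shifted
    -- sum loses its last term.
    ≡⟨ cong (λ x → suc (a * ∑ (suc n) t + (∑ n (t ∘ suc) + x * a ^ suc n))) (k>n⇒nCk≡0 (n<1+n n)) ⟩
  suc (a * ∑ (suc n) t + (∑ n (t ∘ suc) + 0))
    ≡⟨ cong (λ x → suc (a * ∑ (suc n) t + x)) (+-identityʳ _) ⟩
  suc (a * ∑ (suc n) t + ∑ n (t ∘ suc))                             ≡⟨ +-suc (a * ∑ (suc n) t) _ ⟨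
  a * ∑ (suc n) t + ∑ (suc n) t                                     ≡⟨ +-comm (a * ∑ (suc n) t) _ ⟩
  suc a * ∑ (suc n) t                                               ≡⟨ cong (suc a *_) (binomial n a) ⟨
  suc a ^ suc n                                                     ∎)
  where
  open ≡-Reasoning
  t : ℕ → ℕ
  t k = (n C k) * a ^ k
  l : ∀ a x y b → (x + y) * (a * b) ≡ a * (x * b) + y * (a * b)
  l = solve-∀
  pascal : ∀ k → (suc n C suc k) * a ^ suc k ≡ a * t k + t (suc k)
  pascal k = trans (cong (_* a ^ suc k) (sym (nCk+nC[k+1]≡[n+1]C[k+1] n k))) (l a (n C k) (n C suc k) (a ^ k))

-- By absorption `q` divides (k+1) · (q C (k+1)); Euclid's lemma applies, and k+1 is too small to be
-- a multiple of `q`.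
prime⇒∣C : Prime q → ∀ k → suc k < q → q ∣ q C suc k
prime⇒∣C {suc q′} q-prime k k<q = [ contradiction′ , id ]′ (euclidsLemma (suc k) _ q-prime
  (subst (suc q′ ∣_) (sym ([k+1]*[n+1]C[k+1]≡[n+1]*nCk q′ k)) (m∣m*n (q′ C k))))
  where
  contradiction′ : suc q′ ∣ suc k → suc q′ ∣ suc q′ C suc k
  contradiction′ q∣k = contradiction q∣k (>⇒∤ k<q)

-- Induction on `a`: in the binomial expansion of (a+1)^q only the two outer terms survive modulo
-- `q`.
fermat : Prime q → ∀ a → a ^ q ≈ a [ q ]
fermat {suc (suc q″)} q-prime zero = ≈-refl
fermat {q@(suc q′@(suc q″))} q-prime (suc a) = begin
  suc a ^ q                                  ≡⟨ binomial q a ⟩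
  suc (∑ q (t ∘ suc))                        ≡⟨ cong suc (∑-last q′ (t ∘ suc)) ⟩
  suc (∑ q′ (t ∘ suc) + (q C q) * a ^ q)     ≡⟨ cong (λ x → suc (∑ q′ (t ∘ suc) + x * a ^ q)) (nCn≡1 q) ⟩
  suc (∑ q′ (t ∘ suc) + 1 * a ^ q)
    ≈⟨ ≈-+ (≈-refl {1}) (≈-+ (∑-≈0 q′ middle) (≈-*ˡ 1 (fermat q-prime a))) ⟩
  suc (0 + 1 * a)                            ≡⟨ cong suc (*-identityˡ a) ⟩
  suc a                                      ∎
  where
  open ≈-Reasoning q
  t : ℕ → ℕ
  t k = (q C k) * a ^ k
  middle : ∀ k → k < q′ → t (suc k) ≈ 0 [ q ]
  middle k k<q′ = ∣⇒≈0 (∣m⇒∣m*n (a ^ suc k) (prime⇒∣C q-prime k (s<s k<q′)))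

≈-cancelˡ : Prime q → ∀ c → q ∤ c → c * a ≈ c * b [ q ] → a ≈ b [ q ]
≈-cancelˡ {q} q-prime c q∤c ca≈cb =
  [ (λ a≤b → cancel a≤b ca≈cb) , (λ b≤a → ≈-sym (cancel b≤a (≈-sym ca≈cb))) ]′ (≤-total _ _)
  where
  cancel : ∀ {a b} → a ≤ b → c * a ≈ c * b [ q ] → a ≈ b [ q ]
  cancel {a} {b} a≤b ca≈cb = [ (λ q∣c → contradiction q∣c q∤c) , ∣∸⇒≈ a≤b ]′
    (euclidsLemma c (b ∸ a) q-prime
      (subst (q ∣_) (sym (*-distribˡ-∸ c b a)) (≈⇒∣∸ (*-monoʳ-≤ c a≤b) ca≈cb)))

fermat-unit : Prime q → ∀ a → q ∤ a → a ^ (q ∸ 1) ≈ 1 [ q ]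
fermat-unit {suc q′} q-prime a q∤a = ≈-cancelˡ q-prime a q∤a
  (≈-trans (fermat q-prime a) (≈-reflexive (sym (*-identityʳ a))))

-- Power sums modulo a prime

-- The base runs over 0, ..., q-1, whereas in `S` it runs over 1, ..., q. Thus `S` is `P` with the
-- base shifted by one, which is what the binomial recursion exploits.
P : ℕ → ℕ → ℕ
P r q = ∑ q (_^ r)

S≈P : ∀ r q → S (suc r) q ≈ P (suc r) q [ q ]
S≈P r q = begin
  -- Since 0^(r+1) computes to 0, `S (suc r) q` is by reduction also the sum over 0, ..., q.
  S (suc r) q                ≡⟨ ∑-last q (_^ suc r) ⟩
  P (suc r) q + q ^ suc r    ≈⟨ ≈-+ ≈-refl (∣⇒≈0 (m∣m*n (q ^ r))) ⟩
  P (suc r) q + 0            ≡⟨ +-identityʳ _ ⟩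
  P (suc r) q                ∎
  where open ≈-Reasoning q

[n+1]Cn≡n+1 : ∀ n → suc n C n ≡ suc n
[n+1]Cn≡n+1 n = trans (nCk≡nC[n∸k] (n≤1+n n)) (trans (cong (suc n C_) (m+n∸n≡m 1 n)) (nC1≡n (suc n)))

S-binomial : ∀ n q → S n q ≡ ∑ (suc n) (λ k → (n C k) * P k q)
S-binomial n q = begin
  ∑ q (λ i → suc i ^ n)                                 ≡⟨ ∑-cong q (binomial n) ⟩
  ∑ q (λ i → ∑ (suc n) (λ k → (n C k) * i ^ k))         ≡⟨ ∑-swap q (suc n) (λ i k → (n C k) * i ^ k) ⟩
  ∑ (suc n) (λ k → ∑ q (λ i → (n C k) * i ^ k))         ≡⟨ ∑-cong (suc n) (λ k → ∑-* q (n C k) (_^ k)) ⟩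
  ∑ (suc n) (λ k → (n C k) * P k q)                     ∎
  where open ≡-Reasoning

-- Expanding the left side of Σ (i+1)^(r+1) ≡ Σ i^(r+1) (mod q) binomially leaves (r+1) Σ i^r ≡ 0,
-- because the lower power sums vanish inductively; r + 1 < q makes r + 1 a unit.
P≈0 : Prime q → ∀ r → suc r < q → P r q ≈ 0 [ q ]
P≈0 {q} q-prime = <-rec _ step
  where
  open ≈-Reasoning q
  step : ∀ r → (∀ {j} → j < r → suc j < q → P j q ≈ 0 [ q ]) → suc r < q → P r q ≈ 0 [ q ]
  step r rec r<q = ≈-cancelˡ q-prime (suc r) (>⇒∤ r<q)
    (≈-trans (≈-+-cancelʳ (P (suc r) q) (begin
      suc r * P r q + P (suc r) q
        ≡⟨ cong (suc r * P r q +_) (*-identityˡ _) ⟨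
      suc r * P r q + 1 * P (suc r) q
        ≡⟨ cong₂ (λ x y → x * P r q + y * P (suc r) q) ([n+1]Cn≡n+1 r) (nCn≡1 (suc r)) ⟨
      t r + t (suc r)
        ≈⟨ ≈-+ (≈-+ (≈-sym (∑-≈0 r lower)) (≈-refl {t r})) (≈-refl {t (suc r)}) ⟩
      ∑ r t + t r + t (suc r)                               ≡⟨ cong (_+ t (suc r)) (∑-last r t) ⟨
      ∑ (suc r) t + t (suc r)                               ≡⟨ ∑-last (suc r) t ⟨
      ∑ (2 + r) t                                           ≡⟨ S-binomial (suc r) q ⟨
      S (suc r) q                                           ≈⟨ S≈P r q ⟩
      0 + P (suc r) q                                       ∎))
      (≈-reflexive (sym (*-zeroʳ (suc r)))))
    where
    t : ℕ → ℕ
    t k = (suc r C k) * P k q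
    lower : ∀ j → j < r → t j ≈ 0 [ q ]
    lower j j<r = ≈-trans (≈-*ˡ (suc r C j) (rec j<r (<-trans (s<s j<r) r<q))) (≈-reflexive (*-zeroʳ (suc r C j)))

-- Trading a^q for `a` lowers the exponent by q-1. The positive exponent `suc r` makes this valid
-- even when `q` divides `a`.
^-reduce : Prime q → ∀ a r k → a ^ (suc r + k * (q ∸ 1)) ≈ a ^ suc r [ q ]
^-reduce q-prime a r zero = ≈-reflexive (cong (λ e → a ^ suc e) (+-identityʳ r))
^-reduce {q@(suc q′)} q-prime a r (suc k) = begin
  a ^ (suc r + (q′ + k * q′))       ≡⟨ cong (a ^_) (l r q′ (k * q′)) ⟩
  a ^ (q + (r + k * q′))            ≡⟨ ^-distribˡ-+-* a q (r + k * q′) ⟩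
  a ^ q * a ^ (r + k * q′)          ≈⟨ ≈-* (fermat q-prime a) ≈-refl ⟩
  a ^ (suc r + k * q′)              ≈⟨ ^-reduce q-prime a r k ⟩
  a ^ suc r                         ∎
  where
  open ≈-Reasoning q
  l : ∀ r x y → 1 + r + (x + y) ≡ 1 + x + (r + y)
  l = solve-∀

-- The exponent can be replaced by its nonzero remainder modulo q-1, which lies in the range covered
-- by `P≈0`.
powerSum-∤ : Prime q → q ∸ 1 ∤ n → S n q ≈ 0 [ q ]
powerSum-∤ {q@(suc q′@(suc _))} {n} q-prime q′∤n with n % q′ in r-eq | m≡m%n+[m/n]*n n q′ | m%n<n n q′
... | zero  | _    | _    = contradiction (m%n≡0⇒n∣m n q′ r-eq) q′∤n
... | suc r | n-eq | r<q′ = begin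
  S n q                               ≡⟨ cong (λ e → S e q) n-eq ⟩
  S (suc r + (n / q′) * q′) q         ≈⟨ ∑-≈ q (λ i _ → ^-reduce q-prime (suc i) r (n / q′)) ⟩
  S (suc r) q                         ≈⟨ S≈P r q ⟩
  -- `P≈0` asks for r+2 < q, which is the remainder bound r+1 < q-1 shifted by one.
  P (suc r) q                         ≈⟨ P≈0 q-prime (suc r) (s<s r<q′) ⟩
  0                                   ∎
  where open ≈-Reasoning q

-- The q-1 units each contribute 1, and the last term q^n vanishes because `n` is nonzero. The
-- summand 1 stands on the left because the value -1 is not a natural number.
powerSum-∣ : .{{NonZero n}} → Prime q → q ∸ 1 ∣ n → S n q + 1 ≈ 0 [ q ]
powerSum-∣ {n@(suc n′)} {q@(suc q′)} q-prime (divides k n≡k*q′) = begin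
  S n q + 1                                     ≡⟨ cong (_+ 1) (∑-last q′ _) ⟩
  ∑ q′ (λ i → suc i ^ n) + q ^ n + 1
    ≈⟨ ≈-+ (≈-+ (∑-≈ q′ unit) (∣⇒≈0 (m∣m*n (q ^ n′)))) (≈-refl {1}) ⟩
  ∑ q′ (λ _ → 1) + 0 + 1                        ≡⟨ cong (λ x → x + 0 + 1) (∑-const q′ 1) ⟩
  q′ * 1 + 0 + 1                                ≡⟨ l q′ ⟩
  q                                             ≈⟨ ∣⇒≈0 ∣-refl ⟩
  0                                             ∎
  where
  open ≈-Reasoning q
  l : ∀ x → x * 1 + 0 + 1 ≡ 1 + x
  l = solve-∀
  unit : ∀ i → i < q′ → suc i ^ n ≈ 1 [ q ]
  unit i i<q′ = begin
    suc i ^ n             ≡⟨ cong (suc i ^_) (trans n≡k*q′ (*-comm k q′)) ⟩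
    suc i ^ (q′ * k)      ≡⟨ ^-*-assoc (suc i) q′ k ⟨
    (suc i ^ q′) ^ k      ≈⟨ ≈-^ k (fermat-unit q-prime (suc i) (>⇒∤ (s<s i<q′))) ⟩
    1 ^ k                 ≡⟨ ^-zeroˡ k ⟩
    1                     ∎

*S-∤ : Prime q → ∀ m → q ∸ 1 ∤ n → m * S n q ≈ 0 [ q ]
*S-∤ q-prime m q-1∤n = ≈-trans (≈-*ˡ m (powerSum-∤ q-prime q-1∤n)) (≈-reflexive (*-zeroʳ m))

*S-∣ : .{{NonZero n}} → Prime q → ∀ m → q ∸ 1 ∣ n → m * S n q + m ≈ 0 [ q ]
*S-∣ {n} {q} q-prime m q-1∣n = begin
  m * S n q + m        ≡⟨ l m (S n q) ⟩
  m * (S n q + 1)      ≈⟨ ≈-*ˡ m (powerSum-∣ q-prime q-1∣n) ⟩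
  m * 0                ≡⟨ *-zeroʳ m ⟩
  0                    ∎
  where
  open ≈-Reasoning q
  l : ∀ m s → m * s + m ≡ m * (s + 1)
  l = solve-∀

-- If q-1 did not divide `n`, the left side would vanish, against `q ∤ c`. Otherwise it is -m, and
-- -m ≡ c is the stated divisibility. It serves with c = p at primes other than `p`, and with c = 1
-- at p².
*S≈⇔ : .{{NonZero n}} → Prime q → ∀ m → q ∤ c → m * S n q ≈ c [ q ] ⇔ (q ∸ 1 ∣ n × q ∣ m + c)
*S≈⇔ {n} {q} {c} q-prime m q∤c = mk⇔ to from
  where
  to : m * S n q ≈ c [ q ] → q ∸ 1 ∣ n × q ∣ m + c
  to mS≈c with q ∸ 1 ∣? n
  ... | no q-1∤n  = contradiction (≈0⇒∣ (≈-trans (≈-sym mS≈c) (*S-∤ q-prime m q-1∤n))) q∤c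
  ... | yes q-1∣n = q-1∣n , subst (q ∣_) (+-comm c m)
    (≈0⇒∣ (≈-trans (≈-+ (≈-sym mS≈c) ≈-refl) (*S-∣ q-prime m q-1∣n)))
  from : q ∸ 1 ∣ n × q ∣ m + c → m * S n q ≈ c [ q ]
  from (q-1∣n , q∣m+c) = ≈-+-cancelʳ m
    (≈-trans (*S-∣ q-prime m q-1∣n) (≈-sym (∣⇒≈0 (subst (q ∣_) (+-comm m c) q∣m+c))))

-- Coprimality and products of distinct primes

prime∣prime⇒≡ : Prime p → Prime q → q ∣ p → q ≡ p
prime∣prime⇒≡ p-prime q-prime q∣p with prime⇒irreducible p-prime q∣p
... | inj₁ refl = contradiction q-prime ¬prime[1]
... | inj₂ q≡p  = q≡p

prime∤1 : Prime q → q ∤ 1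
prime∤1 q-prime q∣1 = ¬prime[1] (subst Prime (∣1⇒≡1 q∣1) q-prime)

∤⇒coprime : Prime q → q ∤ m → Coprime q m
∤⇒coprime q-prime q∤m (d∣q , d∣m) with prime⇒irreducible q-prime d∣q
... | inj₁ d≡1  = d≡1
... | inj₂ refl = contradiction d∣m q∤m

-- A common divisor of q^(s+1) and `m` is coprime to `q`, so it already divides q^s.
coprime-^ : Coprime q m → ∀ s → Coprime (q ^ s) m
coprime-^ {m = m} c zero    = 1-coprimeTo m
coprime-^ c (suc s) (d∣q*q^s , d∣m) =
  coprime-^ c s (coprime-divisor (λ (e∣d , e∣q) → c (e∣q , ∣-trans e∣d d∣m)) d∣q*q^s , d∣m)

∉⇒∤product : ∀ {qs} → Prime p → All Prime qs → All (_≢ p) qs → p ∤ product qs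
∉⇒∤product p-prime qs-prime qs≢p p∣∏ =
  All.lookup qs≢p (factorisationHasAllPrimeFactors p-prime p∣∏ qs-prime) refl

squarefree⇒unique : ∀ qs → (∀ {q} → q ∈ₗ qs → q * q ∤ product qs) → Unique qs
squarefree⇒unique []       _     = []
squarefree⇒unique (q ∷ qs) sqfree =
  All.tabulate (λ { r∈qs refl → sqfree (here refl) (*-monoʳ-∣ q (∈⇒∣product r∈qs)) }) ∷
  squarefree⇒unique qs (λ r∈qs r²∣ → sqfree (there r∈qs) (∣n⇒∣m*n q r²∣))

≈-mod1 : a ≈ b [ 1 ]
≈-mod1 {a} {b} = ≈-trans (∣⇒≈0 (1∣ a)) (≈-sym (∣⇒≈0 (1∣ b)))

-- Chinese remainder theorem by induction on the list: distinctness keeps the head from dividing the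
-- product of the tail.
≈-product : ∀ {qs} → All Prime qs → Unique qs → (∀ {q} → q ∈ₗ qs → a ≈ b [ q ]) → a ≈ b [ product qs ]
≈-product [] [] _ = ≈-mod1
≈-product (q-prime ∷ qs-prime) (q≢qs ∷ qs-distinct) a≈b =
  ≈-coprime-* (∤⇒coprime q-prime (∉⇒∤product q-prime qs-prime (All.map ≢-sym q≢qs)))
    (a≈b (here refl)) (≈-product qs-prime qs-distinct (a≈b ∘ there))

-- What every positive `n` admits. The bound on `s` and the distinctness of `qs` are left out, since
-- they come only from the congruence for `S n n`.
record PartialFactorisation (p n : ℕ) : Set where
  field
    s        : ℕ
    qs       : List ℕ
    n≡       : n ≡ p ^ s * product qs
    qs-prime : All Prime qs
    qs≢p     : All (_≢ p) qs

separate : ∀ p {L} → All Prime L → PartialFactorisation p (product L)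
separate p [] = record { s = 0 ; qs = [] ; n≡ = refl ; qs-prime = [] ; qs≢p = [] }
separate p {x ∷ L} (x-prime ∷ L-prime) with separate p L-prime | x ≟ p
... | record { s = s ; qs = qs ; n≡ = n≡ ; qs-prime = qs-prime ; qs≢p = qs≢p } | yes refl = record
  { s = suc s ; qs = qs ; n≡ = trans (cong (x *_) n≡) (sym (*-assoc x (x ^ s) _))
  ; qs-prime = qs-prime ; qs≢p = qs≢p }
... | record { s = s ; qs = qs ; n≡ = n≡ ; qs-prime = qs-prime ; qs≢p = qs≢p } | no x≢p = record
  { s = s ; qs = x ∷ qs ; n≡ = trans (cong (x *_) n≡) (l x (p ^ s) _)
  ; qs-prime = x-prime ∷ qs-prime ; qs≢p = x≢p ∷ qs≢p }
  where
  l : ∀ x y z → x * (y * z) ≡ y * (x * z)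
  l = solve-∀

-- Opened only here: with +_ in scope, sections such as (c +_) on ℕ do not parse.
import Data.Integer.Base as ℤ
open import Data.Integer.Base using (+_; 0ℤ)

-- Translation to integer congruences

∣+a-+b∣≡b∸a : a ≤ b → ℤ.∣ + a ℤ.- + b ∣ ≡ b ∸ a
∣+a-+b∣≡b∸a {a} {b} a≤b = trans (cong ℤ.∣_∣ ([+m]-[+n]≡m⊖n a b)) (∣⊖∣-≤ a≤b)

∣+a-+b∣-comm : ∀ a b → ℤ.∣ + a ℤ.- + b ∣ ≡ ℤ.∣ + b ℤ.- + a ∣
∣+a-+b∣-comm a b = trans (cong ℤ.∣_∣ ([+m]-[+n]≡m⊖n a b))
  (trans (∣m⊖n∣≡∣n⊖m∣ a b) (cong ℤ.∣_∣ (sym ([+m]-[+n]≡m⊖n b a))))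

≈⇒mod : ∀ m a b → a ≈ b [ m ] → + a ≡ + b [mod m ]
≈⇒mod m a b p with ≤-total a b
... | inj₁ a≤b = subst (m ∣_) (sym (∣+a-+b∣≡b∸a a≤b)) (≈⇒∣∸ a≤b p)
... | inj₂ b≤a = subst (m ∣_) (sym (trans (∣+a-+b∣-comm a b) (∣+a-+b∣≡b∸a b≤a))) (≈⇒∣∸ b≤a (≈-sym p))

mod⇒≈ : ∀ m a b → + a ≡ + b [mod m ] → a ≈ b [ m ]
mod⇒≈ m a b p with ≤-total a b
... | inj₁ a≤b = ∣∸⇒≈ a≤b (subst (m ∣_) (∣+a-+b∣≡b∸a a≤b) p)
... | inj₂ b≤a = ≈-sym (∣∸⇒≈ b≤a (subst (m ∣_) (trans (∣+a-+b∣-comm a b) (∣+a-+b∣≡b∸a b≤a)) p))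

∣⇒mod0 : ∀ m a → m ∣ a → + a ≡ 0ℤ [mod m ]
∣⇒mod0 m a m∣a = ≈⇒mod m a 0 (∣⇒≈0 m∣a)

mod0⇒∣ : ∀ m a → + a ≡ 0ℤ [mod m ] → m ∣ a
mod0⇒∣ m a a≡0 = ≈0⇒∣ (mod⇒≈ m a 0 a≡0)

-- Local criteria at a prime and at its square

-- With n = (q m) q, the sum is q · (m · S n q) modulo q². Cancelling `q` from both sides and from
-- the modulus leaves m · S n q ≡ 1 modulo `q`, which `*S≈⇔` decides.
S≈q[q²]⇔ : .{{NonZero n}} → Prime q → n ≡ m * (q ^ 2) →
           S n n ≈ q [ q * q ] ⇔ (q ∸ 1 ∣ n × q ∣ m + 1)
S≈q[q²]⇔ {n} {q} {m} q-prime n≡m*q² = mk⇔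
  (λ S≈q → to (≈-unscale q (≈-trans (≈-sym S≈q*mS) (≈-trans S≈q (≈-reflexive (sym (*-identityʳ q)))))))
  (λ h → ≈-trans S≈q*mS (≈-trans (≈-scale q (from h)) (≈-reflexive (*-identityʳ q))))
  where
  open Equivalence (*S≈⇔ {n} q-prime m (prime∤1 q-prime))
  instance
    q≢0 : NonZero q
    q≢0 = prime⇒nonZero q-prime
  l₁ : ∀ m q → m * (q * (q * 1)) ≡ (q * m) * q
  l₁ = solve-∀
  S≈q*mS : S n n ≈ q * (m * S n q) [ q * q ]
  S≈q*mS = ≈-trans (S≈mS (q * m) (trans n≡m*q² (l₁ m q))) (≈-reflexive (*-assoc q m (S n q)))

S≈c[q]⇔ : .{{NonZero n}} → Prime q → n ≡ m * q → q ∤ c →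
          S n n ≈ c [ q ] ⇔ (q ∸ 1 ∣ n × q ∣ m + c)
S≈c[q]⇔ {n} {q} {m} q-prime n≡m*q q∤c = mk⇔
  (λ S≈c → to (≈-trans (≈-sym S≈) S≈c)) (λ h → ≈-trans S≈ (from h))
  where
  open Equivalence (*S≈⇔ {n} q-prime m q∤c)
  S≈ : S n n ≈ m * S n q [ q ]
  S≈ = ≈-∣ (m∣m*n q) (S≈mS m n≡m*q)

-- Necessity and sufficiency

module _ (p : ℕ) (p-prime : Prime p) (n : ℕ) .{{_ : NonZero n}} where

  private instance
    p≢0 : NonZero p
    p≢0 = prime⇒nonZero p-prime
    p²≢0 : NonZero (p ^ 2)
    p²≢0 = m^n≢0 p 2

  Conditions : FactorisationAt p n → Set
  Conditions f = let open FactorisationAt f in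
    (∀ {q} (q∈qs : q ∈ₗ qs) →
      (q ∸ 1 ∣ n) ×
      (+ (_/_ n q {{qs-nonZero q∈qs}} + p) ≡ 0ℤ [mod q ])) ×
    (s ≡ 1 → p ∸ 1 ∤ n) ×
    (s ≡ 2 → (p ∸ 1 ∣ n) × (+ (n / (p ^ 2) + 1) ≡ 0ℤ [mod p ]))

  ≢p⇒∤p : Prime q → q ≢ p → q ∤ p
  ≢p⇒∤p q-prime q≢p = q≢p ∘ prime∣prime⇒≡ p-prime q-prime

  module Necessity (S≈p : S n n ≈ p [ n ]) where

    away : (q-prime : Prime q) → q ≢ p → q ∣ n →
           (q ∸ 1 ∣ n) × q ∣ (_/_ n q {{prime⇒nonZero q-prime}} + p)
    away {q} q-prime q≢p q∣n = Equivalence.to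
      (S≈c[q]⇔ q-prime (sym (m/n*n≡m q∣n)) (≢p⇒∤p q-prime q≢p)) (≈-∣ q∣n S≈p)
      where instance _ = prime⇒nonZero q-prime

    away-square : Prime q → q ≢ p → q * q ∤ n
    away-square {q} q-prime q≢p q²∣n = ≢p⇒∤p q-prime q≢p
      -- If q² divides `n`, then `q` divides n/q, so q ∣ n/q + p forces q ∣ p.
      (∣m+n∣m⇒∣n (proj₂ (away q-prime q≢p (m*n∣⇒m∣ q q q²∣n))) (m*n∣o⇒m∣o/n q q q²∣n))
      where instance _ = prime⇒nonZero q-prime

    at-square : p ^ 2 ∣ n → (p ∸ 1 ∣ n) × p ∣ n / (p ^ 2) + 1
    at-square p²∣n = Equivalence.to (S≈q[q²]⇔ p-prime (sym (m/n*n≡m p²∣n)))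
      (≈-∣ (subst (_∣ n) (cong (p *_) (*-identityʳ p)) p²∣n) S≈p)

    at-cube : p ^ 3 ∤ n
    at-cube p³∣n = prime∤1 p-prime
      -- Here `p` divides both n/p² and n/p² + 1, hence 1.
      (∣m+n∣m⇒∣n (proj₂ (at-square (m*n∣⇒n∣ p (p ^ 2) p³∣n))) (m*n∣o⇒m∣o/n p (p ^ 2) p³∣n))

    -- If p-1 divided `n`, then S n n ≡ -m modulo `p`, while S n n ≡ p ≡ 0; so `p` would divide `m`.
    at-simple : n ≡ m * p → p ∤ m → p ∸ 1 ∤ n
    at-simple {m} n≡m*p p∤m p-1∣n = p∤m (≈0⇒∣ (begin
      0 + m              ≈⟨ ≈-+ (≈-sym (∣⇒≈0 ∣-refl)) ≈-refl ⟩
      p + m              ≈⟨ ≈-+ (≈-∣ (subst (p ∣_) (sym n≡m*p) (n∣m*n m)) S≈p) ≈-refl ⟨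
      S n n + m          ≈⟨ ≈-+ (≈-∣ (m∣m*n p) (S≈mS m n≡m*p)) ≈-refl ⟩
      m * S n p + m      ≈⟨ *S-∣ p-prime m p-1∣n ⟩
      0                  ∎))
      where open ≈-Reasoning p

    factorisation : FactorisationAt p n
    factorisation = record
      { s               = s
      ; qs              = qs
      ; s≤2             = ≮⇒≥ (λ 2<s → at-cube (∣-trans (^-∣ 2<s) (subst (p ^ s ∣_) (sym n≡p^s*∏) (m∣m*n _))))
      ; isFactorisation = n≡p^s*∏
      ; qs-prime        = qs-prime
      ; qs-distinct     = squarefree⇒unique qs λ q∈qs q²∣∏ →
          away-square (All.lookup qs-prime q∈qs) (All.lookup qs≢p q∈qs)
            (subst (_ ∣_) (sym n≡p^s*∏) (∣n⇒∣m*n (p ^ s) q²∣∏))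
      ; qs≢p            = qs≢p
      }
      where
      open PrimeFactorisation (factorise n)
      open PartialFactorisation (separate p factorsPrime)
        renaming (n≡ to ∏≡p^s*∏)
      n≡p^s*∏ : n ≡ p ^ s * product qs
      n≡p^s*∏ = trans isFactorisation ∏≡p^s*∏
      ^-∣ : m ≤ k → p ^ m ∣ p ^ k
      ^-∣ z≤n       = 1∣ _
      ^-∣ (s≤s m≤k) = *-monoʳ-∣ p (^-∣ m≤k)

    conditions : ∀ f → Conditions f
    conditions f = awayConditions , simpleCondition , squareCondition
      where
      open FactorisationAt f
      awayConditions : ∀ {q} (q∈qs : q ∈ₗ qs) →
        (q ∸ 1 ∣ n) × (+ (_/_ n q {{qs-nonZero q∈qs}} + p) ≡ 0ℤ [mod q ])
      awayConditions {q} q∈qs = map₂ (∣⇒mod0 q _)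
        (away (All.lookup qs-prime q∈qs) (All.lookup qs≢p q∈qs)
          (subst (q ∣_) (sym isFactorisation) (∣n⇒∣m*n (p ^ s) (∈⇒∣product q∈qs))))
      simpleCondition : s ≡ 1 → p ∸ 1 ∤ n
      simpleCondition s≡1 = at-simple
        (trans isFactorisation (trans (cong (λ e → p ^ e * product qs) s≡1)
          (trans (cong (_* product qs) (*-identityʳ p)) (*-comm p _))))
        (∉⇒∤product p-prime qs-prime qs≢p)
      squareCondition : s ≡ 2 → (p ∸ 1 ∣ n) × (+ (n / (p ^ 2) + 1) ≡ 0ℤ [mod p ])
      squareCondition s≡2 = map₂ (∣⇒mod0 p (n / (p ^ 2) + 1))
        (at-square (subst (λ e → p ^ e ∣ n) s≡2 (subst (p ^ s ∣_) (sym isFactorisation) (m∣m*n _))))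

  sufficiency : ∀ f → Conditions f → S n n ≈ p [ n ]
  sufficiency f (awayConditions , simpleCondition , squareCondition) =
    subst (S n n ≈ p [_]) (sym isFactorisation)
      (≈-coprime-* (coprime-^ (∤⇒coprime p-prime p∤∏) s) (at-p s refl) (≈-product qs-prime qs-distinct away))
    where
    open FactorisationAt f
    p∤∏ : p ∤ product qs
    p∤∏ = ∉⇒∤product p-prime qs-prime qs≢p
    away : q ∈ₗ qs → S n n ≈ p [ q ]
    away {q} q∈qs = Equivalence.from
      (S≈c[q]⇔ q-prime (sym (m/n*n≡m q∣n)) (≢p⇒∤p q-prime (All.lookup qs≢p q∈qs)))
      (map₂ (mod0⇒∣ q _) (awayConditions q∈qs))
      where
      instance _ = qs-nonZero q∈qs
      q-prime : Prime q
      q-prime = All.lookup qs-prime q∈qs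
      q∣n : q ∣ n
      q∣n = subst (q ∣_) (sym isFactorisation) (∣n⇒∣m*n (p ^ s) (∈⇒∣product q∈qs))
    -- The case split is on a fresh `e` tied to `s` by an equation, since `s` is a projection of
    -- `f`.
    at-p : ∀ e → e ≡ s → S n n ≈ p [ p ^ e ]
    at-p 0 _ = ≈-mod1
    -- The target `p` is 0 modulo `p`, so it suffices that the power sum vanishes, which condition
    -- (iii) ensures.
    at-p 1 refl = subst (S n n ≈ p [_]) (sym (*-identityʳ p)) (begin
      S n n                 ≈⟨ ≈-∣ (m∣m*n p) (S≈mS (product qs) (trans isFactorisation
                                 (trans (cong (_* product qs) (*-identityʳ p)) (*-comm p _)))) ⟩
      product qs * S n p    ≈⟨ *S-∤ p-prime (product qs) (simpleCondition refl) ⟩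
      0                     ≈⟨ ∣⇒≈0 ∣-refl ⟨
      p                     ∎)
      where open ≈-Reasoning p
    at-p 2 refl = subst (S n n ≈ p [_]) (cong (p *_) (sym (*-identityʳ p)))
      (Equivalence.from (S≈q[q²]⇔ p-prime (sym (m/n*n≡m (subst (p ^ 2 ∣_) (sym isFactorisation) (m∣m*n _)))))
        (map₂ (mod0⇒∣ p (n / (p ^ 2) + 1)) (squareCondition refl)))
    at-p (suc (suc (suc e))) e≡s = contradiction (subst (_≤ 2) (sym e≡s) s≤2) λ { (s≤s (s≤s ())) }

theorem1 : (p : ℕ) (p-prime : Prime p) (n : ℕ) .{{_ : NonZero n}} →
    n ∈ 𝓜 (+ p) ⇔
    (Σ[ f ∈ FactorisationAt p n ]
    let open FactorisationAt f in
    (∀ {q} (q∈qs : q ∈ₗ qs) →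
    (q ∸ 1 ∣ n) ×
    (+ (_/_ n q {{qs-nonZero q∈qs}} + p) ≡ 0ℤ [mod q ])) ×
    (s ≡ 1 → p ∸ 1 ∤ n) ×
    (s ≡ 2 →
    (p ∸ 1 ∣ n) ×
    (+ (_/_ n (p ^ 2) {{m^n≢0 p 2 {{prime⇒nonZero p-prime}}}} + 1) ≡ 0ℤ [mod p ])))
theorem1 p p-prime n = mk⇔
  (λ (_ , S≡p) → let open Necessity p p-prime n (mod⇒≈ n (S n n) p S≡p) in factorisation , conditions factorisation)
  -- The hypothesis `NonZero n` is irrelevant, so the relevant component of `𝓜` is rebuilt from n ≢
  -- 0.
  (λ (f , conds) → ≢-nonZero (≢-nonZero⁻¹ n) , ≈⇒mod n (S n n) p (sufficiency p p-prime n f conds))
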